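{- For every formula $\phi\in\mathcal{L}_{\mathsf{TDS}}$: if $\vdash_{\mathsf{TDS}}\phi$ (i.e. $\phi$ is a theorem of the axiom system $\mathsf{TDS}$), then $\models\phi$, i.e. $M,w\models\phi$ for every $\mathsf{TDS}$-model $M$ and every world $w$ of $M$.
   Context: **Language.** Let $Ag=\{1,2,\dots,n\}$ be a finite set of agent labels and $Var=\{p_1,p_2,p_3,\dots\}$ a countable set of propositional variables. $\mathcal{L}_{\mathsf{TDS}}$ is given by $\phi ::= p \mid \neg\phi \mid \phi\land\phi \mid \Box\phi \mid [i]\phi \mid [Ag]\phi \mid \mathsf{G}\phi \mid \mathsf{H}\phi \mid \otimes_i\phi$ with $i\in Ag$, $p\in Var$. $\lor,\rightarrow,\leftrightarrow,\bot,\top$ are defined as usual. Duals: $\Diamond:=\neg\Box\neg$, $\langle i\rangle:=\neg[i]\neg$, $\langle Ag\rangle:=\neg[Ag]\neg$, $\ominus_i:=\neg\otimes_i\neg$, $\mathsf{F}:=\neg\mathsf{G}\neg$, $\mathsf{P}:=\neg\mathsf{H}\neg$. **$\mathsf{TDS}$-frames.** A $\mathsf{TDS}$-frame is a tuple $F=(W,R_\Box,\{R_{[i]}\}_{i\in Ag},R_{[Ag]},R_{\mathsf G},R_{\mathsf H},\{R_{\otimes_i}\}_{i\in Ag})$ with $W$ a non-empty set and all relations binary on $W$; write $R(w)=\{v\in W: (w,v)\in R\}$ for a relation $R$. It is required that: - $R_\Box$, all $R_{[i]}$, and $R_{[Ag]}$ are equivalence relations, and for all $i\in Ag$: (C1)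 $R_{[i]}\subseteq R_\Box$; (C2) for all $u_1,\dots,u_n\in W$, if $R_\Box u_iu_j$ for all $1\le i,j\le n$, then $\bigcap_{i}R_{[i]}(u_i)\neq\emptyset$; (C3) for all $w$, $R_{[Ag]}(w)\subseteq\bigcap_{i\in Ag}R_{[i]}(w)$. - $R_{\mathsf G}$ is transitive and serial, $R_{\mathsf H}$ is the converse of $R_{\mathsf G}$, and: (T4) if $R_{\mathsf G}wu$ and $R_{\mathsf G}wv$ then $R_{\mathsf G}uv$, $u=v$, or $R_{\mathsf G}vu$; (T5) if $R_{\mathsf H}wu$ and $R_{\mathsf H}wv$ then $R_{\mathsf H}uv$, $u=v$, or $R_{\mathsf H}vu$; (T6) $R_{\mathsf G}\circ R_\Box\subseteq R_{[Ag]}\circ R_{\mathsf G}$, i.e. if $R_{\mathsf G}wu$ and $R_\Box uv$ then there is $x$ with $R_{[Ag]}wx$ and $R_{\mathsf G}xv$; (T7) if $u\in R_\Box(w)$ then $u\notin R_{\mathsf G}(w)$. - For all $i\in Ag$: (D8) $R_{\otimes_i}\subseteq R_\Box$; (D9) for all $w$ there is $v$ with $R_\Box wv$ such that for all $u$, $R_{[i]}vu$ implies $R_{\otimes_i}wu$; (D10) for all $w,v,u,z$, if $R_\Box wv$, $R_\Box wu$ and $R_{\otimes_i}uz$, then $R_{\otimes_i}vz$; (D11) for all $w,v$, if $R_{\otimes_i}wv$ then there is $u$ with $R_\Box wu$, $R_{[i]}uv$, and for all $z$, $R_{[i]}uz$ implies $R_{\otimes_i}wz$. A $\mathsf{TDS}$-model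 is $M=(F,V)$ with $F$ a $\mathsf{TDS}$-frame and $V:Var\to\mathcal{P}(W)$. **Satisfaction.** $M,w\models p$ iff $w\in V(p)$; Boolean clauses as usual; each of $\Box,[i],[Ag],\mathsf G,\mathsf H,\otimes_i$ is the universal modality of the relation $R_\Box,R_{[i]},R_{[Ag]},R_{\mathsf G},R_{\mathsf H},R_{\otimes_i}$ respectively (e.g. $M,w\models\otimes_i\phi$ iff $M,u\models\phi$ for all $u\in R_{\otimes_i}(w)$). **Axiom system $\mathsf{TDS}$** (for all formulae $\phi,\psi,\phi_1,\dots,\phi_n$ and each $i\in Ag$): A0 all propositional tautologies; A1 $\Box(\phi\to\psi)\to(\Box\phi\to\Box\psi)$; A2 $\Box\phi\to\phi$; A3 $\Diamond\phi\to\Box\Diamond\phi$; A4 $[i](\phi\to\psi)\to([i]\phi\to[i]\psi)$; A5 $[i]\phi\to\phi$; A6 $\langle i\rangle\phi\to[i]\langle i\rangle\phi$; A7 $[Ag](\phi\to\psi)\to([Ag]\phi\to[Ag]\psi)$; A8 $[Ag]\phi\to\phi$; A9 $\langle Ag\rangle\phi\to[Ag]\langle Ag\rangle\phi$; A10 $\bigwedge_{1\le i\le n}\Diamond[i]\phi_i\to\Diamond\bigwedge_{1\le i\le n}[i]\phi_i$; A11 $\bigwedge_{1\le i\le n}[i]\phi_i\to[Ag]\bigwedge_{1\le i\le n}\phi_i$; A12 $\otimes_i(\phi\to\psi)\to(\otimes_i\phi\to\otimes_i\psi)$; A13 $\Box\phi\to([i]\phi\land\otimes_i\phi)$; A14 $\otimes_i\phi\to\Diamond[i]\phi$;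 A15 $\Diamond\otimes_i\phi\to\Box\otimes_i\phi$; A16 $\Box([i]\phi\to[i]\psi)\to(\otimes_i\phi\to\otimes_i\psi)$; A17 $\mathsf G(\phi\to\psi)\to(\mathsf G\phi\to\mathsf G\psi)$; A18 $\mathsf G\phi\to\mathsf G\mathsf G\phi$; A19 $\mathsf G\phi\to\mathsf F\phi$; A20 $\mathsf H(\phi\to\psi)\to(\mathsf H\phi\to\mathsf H\psi)$; A21 $\phi\to\mathsf G\mathsf P\phi$; A22 $\phi\to\mathsf H\mathsf F\phi$; A23 $\mathsf F\mathsf P\phi\to\mathsf P\phi\lor\phi\lor\mathsf F\phi$; A24 $\mathsf P\mathsf F\phi\to\mathsf P\phi\lor\phi\lor\mathsf F\phi$; A25 $\mathsf F\Diamond\phi\to\langle Ag\rangle\mathsf F\phi$. Rules: R0 from $\vdash\psi\to\phi$ and $\vdash\psi$ infer $\vdash\phi$; R1 from $\vdash\phi$ infer $\vdash[\alpha]\phi$ for $[\alpha]\in\{\Box,\mathsf G,\mathsf H\}$; R2 from $\vdash(\Box\neg p\land\Box(\mathsf Gp\land\mathsf Hp))\to\phi$ infer $\vdash\phi$, where $p\in Var$ does not occur in $\phi$. $\vdash_{\mathsf{TDS}}\phi$ means $\phi$ is derivable from these axioms and rules. -}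

module Defs where

open import Data.Bool.Base using (Bool; true; not) renaming (_∧_ to _∧ᵇ_)
open import Data.Fin.Base using (Fin; zero; suc)
open import Data.Nat.Base using (ℕ; zero; suc)
open import Data.Product.Base using (_×_; ∃-syntax)
open import Data.Sum.Base using (_⊎_)
open import Function.Bundles using (_⇔_)
open import Level using (Level) renaming (suc to lsuc)
open import Relation.Binary.Core using (Rel; _⇒_)
open import Relation.Binary.Definitions using (Transitive)
open import Relation.Binary.PropositionalEquality.Core using (_≡_)
open import Relation.Binary.Structures using (IsEquivalence)
open import Relation.Nullary.Negation.Core using (¬_)
open import Relation.Unary using (Pred; _∈_)

private
  variable
    n : ℕ

Var : Set
Var = ℕ

infix  8 ∼_ □_ [Ag]_ G_ H_ ◇_ ⟨Ag⟩_ F_ P_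
infix  8 [_]_ ⊗[_]_ ⟨_⟩_ ⊖[_]_
infixr 7 _∧_
infixr 6 _∨_
infixr 5 _⊃_ _⊃⊂_

-- The agents are Ag = Fin n.
data Formula (n : ℕ) : Set where
  var   : Var → Formula n
  ∼_    : Formula n → Formula n
  _∧_   : Formula n → Formula n → Formula n
  □_    : Formula n → Formula n
  [_]_  : Fin n → Formula n → Formula n
  [Ag]_ : Formula n → Formula n
  G_    : Formula n → Formula n
  H_    : Formula n → Formula n
  ⊗[_]_ : Fin n → Formula n → Formula n

_∨_ _⊃_ _⊃⊂_ : Formula n → Formula n → Formula n
φ ∨ ψ  = ∼ (∼ φ ∧ ∼ ψ)
φ ⊃ ψ  = ∼ (φ ∧ ∼ ψ)
φ ⊃⊂ ψ = (φ ⊃ ψ) ∧ (ψ ⊃ φ)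

⊥′ ⊤′ : Formula n
⊥′ = var 0 ∧ ∼ var 0
⊤′ = ∼ ⊥′

◇_ ⟨Ag⟩_ F_ P_ : Formula n → Formula n
◇ φ    = ∼ (□ (∼ φ))
⟨Ag⟩ φ = ∼ ([Ag] (∼ φ))
F φ    = ∼ (G (∼ φ))
P φ    = ∼ (H (∼ φ))

⟨_⟩_ ⊖[_]_ : Fin n → Formula n → Formula n
⟨ i ⟩ φ  = ∼ ([ i ] (∼ φ))
⊖[ i ] φ = ∼ (⊗[ i ] (∼ φ))

-- ⊤′ occurs only in the empty conjunction, so that for a nonempty index set
-- ⋀ φ is literally φ₁ ∧ (φ₂ ∧ (… ∧ φₖ)).
⋀ : ∀ {k} → (Fin k → Formula n) → Formula n
⋀ {k = zero}        φ = ⊤′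
⋀ {k = suc zero}    φ = φ zero
⋀ {k = suc (suc k)} φ = φ zero ∧ ⋀ (λ i → φ (suc i))

_OccursIn_ : Var → Formula n → Set
p OccursIn (var q)    = p ≡ q
p OccursIn (∼ φ)      = p OccursIn φ
p OccursIn (φ ∧ ψ)    = (p OccursIn φ) ⊎ (p OccursIn ψ)
p OccursIn (□ φ)      = p OccursIn φ
p OccursIn ([ i ] φ)  = p OccursIn φ
p OccursIn ([Ag] φ)   = p OccursIn φ
p OccursIn (G φ)      = p OccursIn φ
p OccursIn (H φ)      = p OccursIn φ
p OccursIn (⊗[ i ] φ) = p OccursIn φ

record Frame (n : ℕ) (ℓ : Level) : Set (lsuc ℓ) where
  field
    W         : Set ℓ
    inhabited : W
    R□        : Rel W ℓ
    R[_]      : Fin n → Rel W ℓ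
    R[Ag]     : Rel W ℓ
    RG        : Rel W ℓ
    RH        : Rel W ℓ
    R⊗[_]     : Fin n → Rel W ℓ

    □-equiv    : IsEquivalence R□
    [i]-equiv  : ∀ i → IsEquivalence R[ i ]
    [Ag]-equiv : IsEquivalence R[Ag]
    C1 : ∀ i → R[ i ] ⇒ R□
    C2 : (u : Fin n → W) → (∀ i j → R□ (u i) (u j)) →
         ∃[ v ] (∀ i → R[ i ] (u i) v)
    C3 : ∀ {w v} → R[Ag] w v → ∀ i → R[ i ] w v

    G-trans    : Transitive RG
    G-serial   : ∀ w → ∃[ v ] RG w v
    H-converse : ∀ {w v} → RH w v ⇔ RG v w
    T4 : ∀ {w u v} → RG w u → RG w v → RG u v ⊎ u ≡ v ⊎ RG v u
    T5 : ∀ {w u v} → RH w u → RH w v → RH u v ⊎ u ≡ v ⊎ RH v u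
    T6 : ∀ {w u v} → RG w u → R□ u v → ∃[ x ] (R[Ag] w x × RG x v)
    T7 : ∀ {w u} → R□ w u → ¬ RG w u

    D8  : ∀ i → R⊗[ i ] ⇒ R□
    D9  : ∀ i w → ∃[ v ] (R□ w v × (∀ u → R[ i ] v u → R⊗[ i ] w u))
    D10 : ∀ i {w v u z} → R□ w v → R□ w u → R⊗[ i ] u z → R⊗[ i ] v z
    D11 : ∀ i {w v} → R⊗[ i ] w v →
          ∃[ u ] (R□ w u × R[ i ] u v × (∀ z → R[ i ] u z → R⊗[ i ] w z))

record Model (n : ℕ) (ℓ : Level) : Set (lsuc ℓ) where
  field
    frame : Frame n ℓ
  open Frame frame public
  field
    V : Var → Pred W ℓ

open Model using (W)

infix 4 _,_⊨_ ⊨[_]_ ⊢_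

-- Truth values are types, so the classical reading of the clauses for ∼ and
-- of the dual modalities requires excluded middle for Set ℓ.
_,_⊨_ : ∀ {ℓ} (M : Model n ℓ) → W M → Formula n → Set ℓ
M , w ⊨ var p    = w ∈ Model.V M p
M , w ⊨ ∼ φ      = ¬ (M , w ⊨ φ)
M , w ⊨ φ ∧ ψ    = (M , w ⊨ φ) × (M , w ⊨ ψ)
M , w ⊨ □ φ      = ∀ u → Model.R□ M w u → M , u ⊨ φ
M , w ⊨ [ i ] φ  = ∀ u → Model.R[_] M i w u → M , u ⊨ φ
M , w ⊨ [Ag] φ   = ∀ u → Model.R[Ag] M w u → M , u ⊨ φ
M , w ⊨ G φ      = ∀ u → Model.RG M w u → M , u ⊨ φ
M , w ⊨ H φ      = ∀ u → Model.RH M w u → M , u ⊨ φ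
M , w ⊨ ⊗[ i ] φ = ∀ u → Model.R⊗[_] M i w u → M , u ⊨ φ

⊨[_]_ : ∀ ℓ → Formula n → Set (lsuc ℓ)
⊨[_]_ {n} ℓ φ = (M : Model n ℓ) (w : W M) → M , w ⊨ φ

-- Boolean evaluation in which variables and formulae with a modality outermost
-- count as atoms; v is only ever consulted on those.
eval : (Formula n → Bool) → Formula n → Bool
eval v (∼ φ)   = not (eval v φ)
eval v (φ ∧ ψ) = eval v φ ∧ᵇ eval v ψ
eval v φ       = v φ

Tautology : Formula n → Set
Tautology φ = ∀ v → eval v φ ≡ true

data ⊢_ {n : ℕ} : Formula n → Set where
  A0  : ∀ {φ} → Tautology φ → ⊢ φ
  A1  : ∀ φ ψ → ⊢ □ (φ ⊃ ψ) ⊃ (□ φ ⊃ □ ψ)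
  A2  : ∀ φ → ⊢ □ φ ⊃ φ
  A3  : ∀ φ → ⊢ ◇ φ ⊃ □ (◇ φ)
  A4  : ∀ i φ ψ → ⊢ [ i ] (φ ⊃ ψ) ⊃ ([ i ] φ ⊃ [ i ] ψ)
  A5  : ∀ i φ → ⊢ [ i ] φ ⊃ φ
  A6  : ∀ i φ → ⊢ ⟨ i ⟩ φ ⊃ [ i ] (⟨ i ⟩ φ)
  A7  : ∀ φ ψ → ⊢ [Ag] (φ ⊃ ψ) ⊃ ([Ag] φ ⊃ [Ag] ψ)
  A8  : ∀ φ → ⊢ [Ag] φ ⊃ φ
  A9  : ∀ φ → ⊢ ⟨Ag⟩ φ ⊃ [Ag] (⟨Ag⟩ φ)
  A10 : ∀ (φ : Fin n → Formula n) →
        ⊢ ⋀ (λ i → ◇ ([ i ] (φ i))) ⊃ ◇ (⋀ (λ i → [ i ] (φ i)))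
  A11 : ∀ (φ : Fin n → Formula n) →
        ⊢ ⋀ (λ i → [ i ] (φ i)) ⊃ [Ag] (⋀ φ)
  A12 : ∀ i φ ψ → ⊢ ⊗[ i ] (φ ⊃ ψ) ⊃ (⊗[ i ] φ ⊃ ⊗[ i ] ψ)
  A13 : ∀ i φ → ⊢ □ φ ⊃ ([ i ] φ ∧ ⊗[ i ] φ)
  A14 : ∀ i φ → ⊢ ⊗[ i ] φ ⊃ ◇ ([ i ] φ)
  A15 : ∀ i φ → ⊢ ◇ (⊗[ i ] φ) ⊃ □ (⊗[ i ] φ)
  A16 : ∀ i φ ψ → ⊢ □ ([ i ] φ ⊃ [ i ] ψ) ⊃ (⊗[ i ] φ ⊃ ⊗[ i ] ψ)
  A17 : ∀ φ ψ → ⊢ G (φ ⊃ ψ) ⊃ (G φ ⊃ G ψ)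
  A18 : ∀ φ → ⊢ G φ ⊃ G (G φ)
  A19 : ∀ φ → ⊢ G φ ⊃ F φ
  A20 : ∀ φ ψ → ⊢ H (φ ⊃ ψ) ⊃ (H φ ⊃ H ψ)
  A21 : ∀ φ → ⊢ φ ⊃ G (P φ)
  A22 : ∀ φ → ⊢ φ ⊃ H (F φ)
  A23 : ∀ φ → ⊢ F (P φ) ⊃ (P φ ∨ φ ∨ F φ)
  A24 : ∀ φ → ⊢ P (F φ) ⊃ (P φ ∨ φ ∨ F φ)
  A25 : ∀ φ → ⊢ F (◇ φ) ⊃ ⟨Ag⟩ (F φ)
  R0  : ∀ {φ ψ} → ⊢ ψ ⊃ φ → ⊢ ψ → ⊢ φ
  R1□ : ∀ {φ} → ⊢ φ → ⊢ □ φ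
  R1G : ∀ {φ} → ⊢ φ → ⊢ G φ
  R1H : ∀ {φ} → ⊢ φ → ⊢ H φ
  R2  : ∀ {φ} p → ¬ (p OccursIn φ) →
        ⊢ (□ (∼ var p) ∧ □ (G (var p) ∧ H (var p))) ⊃ φ → ⊢ φ

{-# OPTIONS --safe #-}

-- Only the irreflexivity rule R2 is not a direct reading of the frame conditions.
-- Given a world w, reinterpret the fresh variable p as the complement of the moment
-- R□(w). By T7 no world of that moment sees the moment along RG or RH, so the
-- antecedent of the premise holds at w, while φ, not mentioning p, is unaffected.
module Submission where

open import Defs
open import Axiom.DoubleNegationElimination using (em⇒dne)
open import Axiom.ExcludedMiddle using (ExcludedMiddle)
open import Data.Empty using (⊥-elim)
open import Data.Fin.Base using (Fin; zero; suc)
open import Data.Nat.Base using (ℕ; zero; suc)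
open import Data.Nat.Properties using (_≟_)
open import Data.Product.Base using (_×_; _,_; proj₁; proj₂; ∃-syntax)
open import Data.Product.Function.NonDependent.Propositional using (_×-⇔_)
open import Data.Sum.Base using (_⊎_; inj₁; inj₂; map₂)
open import Function.Base using (_∘_)
open import Function.Bundles using (_⇔_; mk⇔; Equivalence)
open import Function.Construct.Identity using (⇔-id)
open import Function.Related.TypeIsomorphisms using (¬-cong-⇔)
open import Level using (Level)
open import Relation.Binary.Core using (Rel)
open import Relation.Binary.Definitions using (Reflexive; Symmetric; Transitive)
open import Relation.Binary.PropositionalEquality.Core using (_≡_; refl; subst; sym)
open import Relation.Binary.Structures using (IsEquivalence)
open import Relation.Nullary.Decidable.Core using (does; proof; yes; no)
open import Relation.Nullary.Negation.Core using (¬_)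
open import Relation.Nullary.Reflects using (Reflects; invert; ¬-reflects; _×-reflects_)
open import Relation.Unary using (Pred; _∈_)

open Equivalence using (to; from)

private
  variable
    n : ℕ

-- The Kripke clauses and derived connectives as operations on types: definitionally
-- the values of _,_⊨_ on □, ◇, ⊃, ∨ and their analogues.
module Connectives {ℓ : Level} where

  Box Dia : {W : Set ℓ} → Rel W ℓ → Pred W ℓ → Pred W ℓ
  Box R A w = ∀ u → R w u → A u
  Dia R A w = ¬ Box R (λ u → ¬ A u) w

  infixr 5 _⇛_
  infixr 6 _⩒_

  _⇛_ _⩒_ : Set ℓ → Set ℓ → Set ℓ
  A ⇛ B = ¬ (A × ¬ B)
  A ⩒ B = ¬ (¬ A × ¬ B)

  -- Introduction into the negative encodings is constructive. Getting a function or a witness back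
  -- out takes excluded middle and is left to `Classical`.
  ⇛-intro : {A B : Set ℓ} → (A → B) → A ⇛ B
  ⇛-intro f (a , ¬b) = ¬b (f a)

  ⩒-introˡ : {A B : Set ℓ} → A → A ⩒ B
  ⩒-introˡ a (¬a , _) = ¬a a

  ⩒-introʳ : {A B : Set ℓ} → B → A ⩒ B
  ⩒-introʳ b (_ , ¬b) = ¬b b

  Box-⇔ : {W : Set ℓ} {R : Rel W ℓ} {A B : Pred W ℓ} →
          (∀ u → A u ⇔ B u) → ∀ w → Box R A w ⇔ Box R B w
  Box-⇔ A⇔B w = mk⇔ (λ □a u r → to (A⇔B u) (□a u r)) (λ □b u r → from (A⇔B u) (□b u r))

  Dia-intro : {W : Set ℓ} (R : Rel W ℓ) {A : Pred W ℓ} {w u : W} → R w u → A u → Dia R A w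
  Dia-intro R {u = u} r a □¬a = □¬a u r a

open Connectives

-- The length `k` is kept apart from the number `n` of agents, so that the recursion can shorten the
-- conjunction while its members stay in `Formula n`.
⋀-intro : ∀ {ℓ} (M : Model n ℓ) {w} k (φ : Fin k → Formula n) →
          (∀ i → M , w ⊨ φ i) → M , w ⊨ ⋀ φ
⋀-intro M zero          φ s = λ (a , ¬a) → ¬a a
⋀-intro M (suc zero)    φ s = s zero
⋀-intro M (suc (suc k)) φ s = s zero , ⋀-intro M (suc k) (φ ∘ suc) (s ∘ suc)

⋀-elim : ∀ {ℓ} (M : Model n ℓ) {w} k (φ : Fin k → Formula n) →
         M , w ⊨ ⋀ φ → ∀ i → M , w ⊨ φ i
⋀-elim M (suc zero)    φ s       zero    = s
⋀-elim M (suc (suc k)) φ (s , _) zero    = s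
⋀-elim M (suc (suc k)) φ (_ , s) (suc i) = ⋀-elim M (suc k) (φ ∘ suc) s i

withValuation : ∀ {ℓ} (M : Model n ℓ) → (Var → Pred (Model.W M) ℓ) → Model n ℓ
withValuation M V = record { frame = Model.frame M ; V = V }

-- Both models share all relations, so the induction only has to pass through them. Agreement is
-- assumed at every world because the modal clauses leave `w`.
⊨-coincidence : ∀ {ℓ} (M : Model n ℓ) (V : Var → Pred (Model.W M) ℓ) φ →
                (∀ q → q OccursIn φ → ∀ w → w ∈ Model.V M q ⇔ w ∈ V q) →
                ∀ w → (M , w ⊨ φ) ⇔ (withValuation M V , w ⊨ φ)
⊨-coincidence M V (var q)    V≈ w = V≈ q refl w
⊨-coincidence M V (∼ φ)      V≈ w = ¬-cong-⇔ (⊨-coincidence M V φ V≈ w)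
⊨-coincidence M V (φ ∧ ψ)    V≈ w = ⊨-coincidence M V φ (λ q → V≈ q ∘ inj₁) w
                               ×-⇔ ⊨-coincidence M V ψ (λ q → V≈ q ∘ inj₂) w
⊨-coincidence M V (□ φ)      V≈ = Box-⇔ (⊨-coincidence M V φ V≈)
⊨-coincidence M V ([ i ] φ)  V≈ = Box-⇔ (⊨-coincidence M V φ V≈)
⊨-coincidence M V ([Ag] φ)   V≈ = Box-⇔ (⊨-coincidence M V φ V≈)
⊨-coincidence M V (G φ)      V≈ = Box-⇔ (⊨-coincidence M V φ V≈)
⊨-coincidence M V (H φ)      V≈ = Box-⇔ (⊨-coincidence M V φ V≈)
⊨-coincidence M V (⊗[ i ] φ) V≈ = Box-⇔ (⊨-coincidence M V φ V≈)

_[_≔_] : ∀ {ℓ} {W : Set ℓ} → (Var → Pred W ℓ) → Var → Pred W ℓ → Var → Pred W ℓ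
(V [ p ≔ X ]) q with q ≟ p
... | yes _ = X
... | no _  = V q

-- For a variable `p` the test `p ≟ p` does not reduce, so this equation is proved by cases and
-- later used through `subst`.
≔-hit : ∀ {ℓ} {W : Set ℓ} (V : Var → Pred W ℓ) p X → (V [ p ≔ X ]) p ≡ X
≔-hit V p X with p ≟ p
... | yes _  = refl
... | no p≢p = ⊥-elim (p≢p refl)

≔-miss : ∀ {ℓ} {W : Set ℓ} (V : Var → Pred W ℓ) {p q} X → ¬ q ≡ p →
         ∀ w → w ∈ V q ⇔ w ∈ (V [ p ≔ X ]) q
≔-miss V {p} {q} X q≢p w with q ≟ p
... | yes q≡p = ⊥-elim (q≢p q≡p)
... | no _    = ⇔-id _

-- The case n = 0 is separate: there C2 yields a world unrelated to w.
joint-choice : ∀ {ℓ} (F : Frame n ℓ) {w} (u : Fin n → Frame.W F) →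
               (∀ i → Frame.R□ F w (u i)) →
               ∃[ v ] (Frame.R□ F w v × ∀ i → Frame.R[_] F i (u i) v)
joint-choice {zero}  F {w} u w□u = w , IsEquivalence.refl (Frame.□-equiv F) , λ ()
joint-choice {suc _} F     u w□u =
  let v , uv = C2 u (λ i j → □≈.trans (□≈.sym (w□u i)) (w□u j))
  in v , □≈.trans (w□u zero) (C1 zero (uv zero)) , uv
  where
  open Frame F
  module □≈ = IsEquivalence □-equiv

-- The shared last step for `A23` and `A24`, which have the same consequent and differ only in the
-- linearity condition that supplies the trichotomy.
past-now-future : ∀ {ℓ} (M : Model n ℓ) (φ : Formula n) {w v} → M , v ⊨ φ →
                  Model.RH M w v ⊎ w ≡ v ⊎ Model.RG M w v → M , w ⊨ P φ ∨ φ ∨ F φ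
past-now-future M φ a (inj₁ w>v)         = ⩒-introˡ (Dia-intro (Model.RH M) w>v a)
past-now-future M φ a (inj₂ (inj₁ refl)) = ⩒-introʳ (⩒-introˡ a)
past-now-future M φ a (inj₂ (inj₂ w<v))  =
  ⩒-introʳ (⩒-introʳ (Dia-intro (Model.RG M) w<v a))

module Classical {ℓ : Level} (em : ExcludedMiddle ℓ) where

  open Model
  private
    module □≈ {n} (M : Model n ℓ) = IsEquivalence (□-equiv M)
    module []≈ {n} (M : Model n ℓ) i = IsEquivalence ([i]-equiv M i)
    module [Ag]≈ {n} (M : Model n ℓ) = IsEquivalence ([Ag]-equiv M)

  ⇛-elim : {A B : Set ℓ} → A ⇛ B → A → B
  ⇛-elim f a = em⇒dne em (λ ¬b → f (a , ¬b))

  Dia-elim : {W : Set ℓ} (R : Rel W ℓ) {A : Pred W ℓ} {w : W} →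
             Dia R A w → ∃[ u ] (R w u × A u)
  Dia-elim R d = em⇒dne em (λ ∄ → d (λ u r a → ∄ (u , r , a)))

  Box-K : {W : Set ℓ} (R : Rel W ℓ) {A B : Pred W ℓ} {w : W} →
          Box R (λ u → A u ⇛ B u) w ⇛ (Box R A w ⇛ Box R B w)
  Box-K R = ⇛-intro λ □ab → ⇛-intro λ □a u r → ⇛-elim (□ab u r) (□a u r)

  Box-T : {W : Set ℓ} (R : Rel W ℓ) {A : Pred W ℓ} {w : W} →
          Reflexive R → Box R A w ⇛ A w
  Box-T R rfl = ⇛-intro λ □a → □a _ rfl

  -- Symmetry and transitivity make `R` Euclidean: whatever `w` sees is seen from each `v` that `w`
  -- sees. A refutation at `v` thus becomes one at `w`, and no witness is extracted.
  Dia-5 : {W : Set ℓ} (R : Rel W ℓ) {A : Pred W ℓ} {w : W} →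
          Symmetric R → Transitive R → Dia R A w ⇛ Box R (Dia R A) w
  Dia-5 R sm tr = ⇛-intro λ d v wv □¬a → d λ u wu → □¬a u (tr (sm wv) wu)

  -- Truth at `w`, decided by excluded middle, serves as a Boolean valuation. Modal formulae are
  -- atoms for `eval`, so only negation and conjunction recurse.
  reflects : (M : Model n ℓ) (w : Model.W M) (φ : Formula n) →
             Reflects (M , w ⊨ φ) (eval (λ ψ → does (em {M , w ⊨ ψ})) φ)
  reflects M w φ@(var _)    = proof (em {M , w ⊨ φ})
  reflects M w (∼ φ)        = ¬-reflects (reflects M w φ)
  reflects M w (φ ∧ ψ)      = reflects M w φ ×-reflects reflects M w ψ
  reflects M w φ@(□ _)      = proof (em {M , w ⊨ φ})
  reflects M w φ@([ _ ] _)  = proof (em {M , w ⊨ φ})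
  reflects M w φ@([Ag] _)   = proof (em {M , w ⊨ φ})
  reflects M w φ@(G _)      = proof (em {M , w ⊨ φ})
  reflects M w φ@(H _)      = proof (em {M , w ⊨ φ})
  reflects M w φ@(⊗[ _ ] _) = proof (em {M , w ⊨ φ})

  tautology-valid : {φ : Formula n} → Tautology φ → ⊨[ ℓ ] φ
  tautology-valid {φ = φ} taut M w =
    invert (subst (Reflects (M , w ⊨ φ)) (taut _) (reflects M w φ))

  sound : {φ : Formula n} → ⊢ φ → ⊨[ ℓ ] φ
  sound (A0 {φ} taut) = tautology-valid {φ = φ} taut
  sound (A1 φ ψ) M w = Box-K (R□ M)
  sound (A2 φ) M w = Box-T (R□ M) (□≈.refl M)
  sound (A3 φ) M w = Dia-5 (R□ M) (□≈.sym M) (□≈.trans M)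
  sound (A4 i φ ψ) M w = Box-K (R[_] M i)
  sound (A5 i φ) M w = Box-T (R[_] M i) ([]≈.refl M i)
  sound (A6 i φ) M w = Dia-5 (R[_] M i) ([]≈.sym M i) ([]≈.trans M i)
  sound (A7 φ ψ) M w = Box-K (R[Ag] M)
  sound (A8 φ) M w = Box-T (R[Ag] M) ([Ag]≈.refl M)
  sound (A9 φ) M w = Dia-5 (R[Ag] M) ([Ag]≈.sym M) ([Ag]≈.trans M)
  sound {n} (A10 φ) M w = ⇛-intro λ s →
    let choice i = Dia-elim (R□ M) (⋀-elim M n (λ i → ◇ ([ i ] φ i)) s i)
        v , w□v , uv = joint-choice (frame M) (proj₁ ∘ choice) (proj₁ ∘ proj₂ ∘ choice)
    -- `v` lies in the choice cell of agent `i` at the `i`-th witness, so that witness also governs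
    -- every `x` in the cell of `v`.
    in Dia-intro (R□ M) w□v (⋀-intro M n (λ i → [ i ] φ i) λ i x vx →
         proj₂ (proj₂ (choice i)) x ([]≈.trans M i (uv i) vx))
  sound {n} (A11 φ) M w = ⇛-intro λ s u wu →
    ⋀-intro M n φ λ i → ⋀-elim M n (λ i → [ i ] φ i) s i u (C3 M wu i)
  sound (A12 i φ ψ) M w = Box-K (R⊗[_] M i)
  sound (A13 i φ) M w = ⇛-intro λ □φ →
    (λ u wu → □φ u (C1 M i wu)) , (λ u wu → □φ u (D8 M i wu))
  sound (A14 i φ) M w = ⇛-intro λ ⊗φ →
    let v , w□v , v⊆ = D9 M i w
    in Dia-intro (R□ M) w□v (λ u vu → ⊗φ u (v⊆ u vu))
  sound (A15 i φ) M w = ⇛-intro λ ◇⊗φ v w□v z vz →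
    let u , w□u , ⊗φ = Dia-elim (R□ M) ◇⊗φ
    -- Ideal worlds are the same throughout a moment: `D10` carries `z` from `v` over to `u`.
    in ⊗φ z (D10 M i w□u w□v vz)
  sound (A16 i φ ψ) M w = ⇛-intro λ □imp → ⇛-intro λ ⊗φ v wv →
    -- `D11` places the ideal world `v` in a choice cell consisting of ideal worlds. Hence `[ i ] φ`
    -- holds at `u`, and the implication is applied there.
    let u , w□u , uv , u⊆ = D11 M i wv
    in ⇛-elim (□imp u w□u) (λ z uz → ⊗φ z (u⊆ z uz)) v uv
  sound (A17 φ ψ) M w = Box-K (RG M)
  sound (A18 φ) M w = ⇛-intro λ Gφ u wu v uv → Gφ v (G-trans M wu uv)
  sound (A19 φ) M w = ⇛-intro λ Gφ →
    let u , wu = G-serial M w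
    in Dia-intro (RG M) wu (Gφ u wu)
  sound (A20 φ ψ) M w = Box-K (RH M)
  sound (A21 φ) M w = ⇛-intro λ a u wu → Dia-intro (RH M) (from (H-converse M) wu) a
  sound (A22 φ) M w = ⇛-intro λ a u wu → Dia-intro (RG M) (to (H-converse M) wu) a
  sound (A23 φ) M w = ⇛-intro λ FPφ →
    let u , w<u , Pφ = Dia-elim (RG M) FPφ
        v , v<u , a  = Dia-elim (RH M) Pφ
    -- Both `w` and `v` lie in the past of `u`, so `T5` compares them.
    in past-now-future M φ a (comparable (T5 M (from (H-converse M) w<u) v<u))
    where
    comparable : ∀ {v} → RH M w v ⊎ w ≡ v ⊎ RH M v w → RH M w v ⊎ w ≡ v ⊎ RG M w v
    comparable = map₂ (map₂ (to (H-converse M)))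
  sound (A24 φ) M w = ⇛-intro λ PFφ →
    let u , u<w , Fφ = Dia-elim (RH M) PFφ
        v , u<v , a  = Dia-elim (RG M) Fφ
    in past-now-future M φ a (comparable (T4 M (to (H-converse M) u<w) u<v))
    where
    comparable : ∀ {v} → RG M w v ⊎ w ≡ v ⊎ RG M v w → RH M w v ⊎ w ≡ v ⊎ RG M w v
    -- `T4`, applied at the common past world `u`, lists the future of `w` first, so the outer cases
    -- change places.
    comparable (inj₁ w<v)        = inj₂ (inj₂ w<v)
    comparable (inj₂ (inj₁ w≡v)) = inj₂ (inj₁ w≡v)
    comparable (inj₂ (inj₂ v<w)) = inj₁ (from (H-converse M) v<w)
  sound (A25 φ) M w = ⇛-intro λ F◇φ →
    let u , w<u , ◇φ = Dia-elim (RG M) F◇φ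
        v , u□v , a  = Dia-elim (R□ M) ◇φ
        -- `T6` trades moving within the later moment for a move within the present cell of `Ag`,
        -- ending at the same `v`.
        x , wx , x<v = T6 M w<u u□v
    in Dia-intro (R[Ag] M) wx (Dia-intro (RG M) x<v a)
  sound (R0 ⊢imp ⊢ψ) M w = ⇛-elim (sound ⊢imp M w) (sound ⊢ψ M w)
  sound (R1□ ⊢φ) M w u _ = sound ⊢φ M u
  sound (R1G ⊢φ) M w u _ = sound ⊢φ M u
  sound (R1H ⊢φ) M w u _ = sound ⊢φ M u
  -- The induction hypothesis is used in `M′` rather than `M`, so the induction must range over all
  -- models.
  sound (R2 {φ} p p∉φ ⊢imp) M w = from coincidence (⇛-elim (sound ⊢imp M′ w) antecedent)
    where
    outside : Pred (W M) ℓ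
    outside u = ¬ R□ M w u

    M′ : Model _ ℓ
    M′ = withValuation M (V M [ p ≔ outside ])

    coincidence : (M , w ⊨ φ) ⇔ (M′ , w ⊨ φ)
    coincidence = ⊨-coincidence M _ φ
      (λ q q∈φ → ≔-miss (V M) outside λ { refl → p∉φ q∈φ }) w

    p-true : ∀ {u} → u ∈ outside → M′ , u ⊨ var p
    p-true {u} = subst (u ∈_) (sym (≔-hit (V M) p outside))

    p-false : ∀ {u} → R□ M w u → ¬ (M′ , u ⊨ var p)
    p-false {u} w□u up = subst (u ∈_) (≔-hit (V M) p outside) up w□u

    antecedent : M′ , w ⊨ □ (∼ var p) ∧ □ (G (var p) ∧ H (var p))
    antecedent = (λ u → p-false) , λ u w□u →
      -- If `v` belonged to the moment of `w`, then `u` and `v` would share a moment while one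
      -- precedes the other.
      (λ v u<v → p-true λ w□v → T7 M (□≈.trans M (□≈.sym M w□u) w□v) u<v) ,
      (λ v v<u → p-true λ w□v →
        T7 M (□≈.trans M (□≈.sym M w□v) w□u) (to (H-converse M) v<u))

theorem1 : ∀ {ℓ} → ExcludedMiddle ℓ → (n : ℕ) (φ : Formula n) → ⊢ φ → ⊨[ ℓ ] φ
theorem1 em n φ = Classical.sound em
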